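{- For every \textsc{Set Once Strip Cover} instance $(x,b)$, the \textsc{RoundRobin} algorithm produces a valid schedule with lifetime $\mathrm{RR}(x,b)=\sum_{i=1}^n b_i/r_i$, where $r_i=\max\{x_i,1-x_i\}$, and $\mathrm{RR}(x,b)\ge \frac{2}{3}\,\mathrm{Opt}(x,b)$, where $\mathrm{Opt}(x,b)$ is the optimal lifetime of $(x,b)$. That is, \textsc{RoundRobin} is a $\frac{3}{2}$-approximation algorithm for \textsc{Set Once Strip Cover}.
   Context: \textsc{Set Once Strip Cover}: An instance is a pair $(x,b)$, where $x=(x_1,\ldots,x_n)\in[0,1]^n$ with $x_1\le\cdots\le x_n$ are sensor locations and $b=(b_1,\ldots,b_n)$, $b_i\ge 0$ rational, are battery charges. A schedule is a pair $(\rho,\tau)$ with $\rho\in[0,1]^n$ (radii) and $\tau\in[0,\infty)^n$ (activation times), each set once. Sensor $i$ covers the interval $[x_i-\rho_i,x_i+\rho_i]$ during the time interval $[\tau_i,\tau_i+b_i/\rho_i]$ and nothing otherwise (a sensor with $\rho_i=0$ covers nothing). A point $(u,t)$ is covered if $u\in[x_i-\rho_i,x_i+\rho_i]$ and $t\in[\tau_i,\tau_i+b_i/\rho_i]$ for some $i$. The lifetime of a schedule is the maximum $T$ such that every $(u,t)\in[0,1]\times[0,T]$ is covered; $\mathrm{Opt}(x,b)$ is the maximum lifetime over all schedules. The \textsc{RoundRobin} algorithm sets $\rho_i=r_i=\max\{x_i,1-x_i\}$ and $\tau_i=\sum_{j=1}^{i-1}b_j/\rho_j$ for every $i$, so that the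 sensors take turns each covering all of $[0,1]$. -}

module Defs where

open import Algebra.Bundles using (CommutativeRing)
import Algebra.Construct.NaturalChoice.Max as NaturalMax
import Algebra.Definitions.RawMonoid as RawMonoidDefs
open import Data.Fin.Base as Fin using (Fin; Fin′; inject)
open import Data.Integer.Base using (ℤ; +_; -[1+_])
open import Data.Nat.Base using (ℕ; suc)
open import Data.Product.Base using (_×_; ∃)
open import Data.Rational.Base as ℚ using (ℚ; 0ℚ; ↥_; ↧ₙ_)
open import Data.Vec.Functional using (Vector)
open import Level using (Level; _⊔_) renaming (suc to lsuc)
open import Relation.Binary.Bundles using (DecTotalOrder)
open import Relation.Binary.Core using (Rel)
import Relation.Binary.Construct.NonStrictToStrict as ToStrict
open import Relation.Binary.Structures using (IsDecTotalOrder)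
open import Relation.Nullary.Negation.Core using (¬_)

-- The classical real numbers, axiomatised as a complete ordered field.  The
-- order is decidable and every inhabited predicate that is bounded above has
-- a least upper bound, as holds of ℝ in classical mathematics.
record RealNumbers (c ℓ₁ ℓ₂ : Level) : Set (lsuc (c ⊔ ℓ₁ ⊔ ℓ₂)) where
  infix 4 _≤_
  infix 8 _⁻¹
  field
    commutativeRing : CommutativeRing c ℓ₁

  open CommutativeRing commutativeRing public

  field
    _≤_             : Rel Carrier ℓ₂
    isDecTotalOrder : IsDecTotalOrder _≈_ _≤_
    +-monoʳ-≤       : ∀ z {x y} → x ≤ y → z + x ≤ z + y
    *-nonneg        : ∀ {x y} → 0# ≤ x → 0# ≤ y → 0# ≤ x * y

    -- Total, but unconstrained (up to congruence) at zero.
    _⁻¹             : Carrier → Carrier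
    ⁻¹-cong         : ∀ {x y} → x ≈ y → x ⁻¹ ≈ y ⁻¹
    ⁻¹-inverseʳ     : ∀ {x} → ¬ (x ≈ 0#) → x * x ⁻¹ ≈ 1#
    0≉1             : ¬ (0# ≈ 1#)

    complete        : (P : Carrier → Set (c ⊔ ℓ₁ ⊔ ℓ₂)) →
                      ∃ P →
                      (∃ λ u → ∀ x → P x → x ≤ u) →
                      ∃ λ s → (∀ x → P x → x ≤ s) ×
                              (∀ u → (∀ x → P x → x ≤ u) → s ≤ u)

  decTotalOrder : DecTotalOrder c ℓ₁ ℓ₂
  decTotalOrder = record { isDecTotalOrder = isDecTotalOrder }

  open ToStrict _≈_ _≤_ public using (_<_)

  open NaturalMax (DecTotalOrder.totalOrder decTotalOrder) public
    using () renaming (_⊔_ to max)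

  open RawMonoidDefs +-rawMonoid public using (sum)

  infixl 7 _/_
  _/_ : Carrier → Carrier → Carrier
  x / y = x * y ⁻¹

  fromℕ : ℕ → Carrier
  fromℕ n = n ×ᴿ 1#
    where open RawMonoidDefs +-rawMonoid renaming (_×_ to _×ᴿ_)

  fromℤ : ℤ → Carrier
  fromℤ (+ n)    = fromℕ n
  fromℤ -[1+ n ] = - fromℕ (suc n)

  fromℚ : ℚ → Carrier
  fromℚ q = fromℤ (↥ q) / fromℕ (↧ₙ q)

  infix 4 _∈[_,_]
  _∈[_,_] : Carrier → Carrier → Carrier → Set ℓ₂
  x ∈[ a , b ] = a ≤ x × x ≤ b

  IsMaximum : ∀ {p} → (Carrier → Set p) → Carrier → Set (c ⊔ ℓ₂ ⊔ p)
  IsMaximum P m = P m × (∀ x → P x → x ≤ m)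

module SetOnceStripCover {c ℓ₁ ℓ₂} (R : RealNumbers c ℓ₁ ℓ₂) where

  open RealNumbers R

  record Instance (n : ℕ) : Set (c ⊔ ℓ₂) where
    field
      location        : Vector Carrier n
      charge          : Vector ℚ n
      location∈[0,1]  : ∀ i → location i ∈[ 0# , 1# ]
      location-sorted : ∀ i j → i Fin.≤ j → location i ≤ location j
      charge-nonneg   : ∀ i → 0ℚ ℚ.≤ charge i

    battery : Vector Carrier n
    battery i = fromℚ (charge i)

  record Schedule (n : ℕ) : Set c where
    field
      radius     : Vector Carrier n
      activation : Vector Carrier n

  IsValid : ∀ {n} → Schedule n → Set ℓ₂
  IsValid S = (∀ i → radius i ∈[ 0# , 1# ]) × (∀ i → 0# ≤ activation i)
    where open Schedule S

  module _ {n} (I : Instance n) where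

    open Instance I

    module _ (S : Schedule n) where

      open Schedule S

      SensorCovers : Fin n → Carrier → Carrier → Set (ℓ₁ ⊔ ℓ₂)
      SensorCovers i u t =
        0# < radius i ×
        u ∈[ location i - radius i , location i + radius i ] ×
        t ∈[ activation i , activation i + battery i / radius i ]

      Covered : Carrier → Carrier → Set (ℓ₁ ⊔ ℓ₂)
      Covered u t = ∃ λ i → SensorCovers i u t

      CoversUntil : Carrier → Set (c ⊔ ℓ₁ ⊔ ℓ₂)
      CoversUntil T =
        0# ≤ T ×
        (∀ u t → u ∈[ 0# , 1# ] → t ∈[ 0# , T ] → Covered u t)

      HasLifetime : Carrier → Set (c ⊔ ℓ₁ ⊔ ℓ₂)
      HasLifetime = IsMaximum CoversUntil

    IsOpt : Carrier → Set (c ⊔ ℓ₁ ⊔ ℓ₂)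
    IsOpt = IsMaximum λ T → ∃ λ S → IsValid S × HasLifetime S T

    r : Vector Carrier n
    r i = max (location i) (1# - location i)

    roundRobin : Schedule n
    roundRobin = record
      { radius     = r
      ; activation = λ i → sum λ (j : Fin′ i) →
                       battery (inject j) / r (inject j)
      }

    RR : Carrier
    RR = sum λ i → battery i / r i

{-# OPTIONS --safe #-}
-- Set Φ u = potential (2u - 1), where potential is odd, equals v (4 - v) on [0,1] and is
-- constant beyond.  Then Φ rises by 6 over [0,1], while a sensor at x of radius ρ raises Φ
-- across its interval by at most 9 ρ / r with r = max x (1 - x).  Hence the sensors active at
-- any moment of a covered period have Σ ρ / r ≥ 2/3.  Integrating over the period [0,T], and
-- noting that sensor i spends in total (b / ρ) (ρ / r) = b / r, gives RR ≥ (2/3) T.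
-- Both the step in space and the step in time are instances of interval-cover: a weighted
-- family of intervals of total weight ≥ K at each point of (A , B) satisfies
-- K (G B - G A) ≤ Σ w (G h - G l) for every monotone G.
module Submission where

open import Defs
import Algebra.Construct.NaturalChoice.Max as NaturalMax
import Algebra.Construct.NaturalChoice.Min as NaturalMin
import Algebra.Properties.Ring as RingProperties
import Algebra.Properties.Semiring.Mult as Mult
import Algebra.Properties.Semiring.Sum as Sum
import Algebra.Solver.Ring as RingSolver
open import Algebra.Solver.Ring.AlmostCommutativeRing
  using (fromCommutativeRing; _-Raw-AlmostCommutative⟶_)
open import Data.Empty using (⊥-elim)
open import Data.Fin.Base using (Fin; Fin′; zero; suc; inject)
open import Data.Integer.Base as ℤ using (ℤ; +_; -[1+_]; _⊖_; _◃_)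
import Data.Integer.Properties as ℤ
open import Data.Maybe.Base using (map)
open import Data.Nat.Base as ℕ using (ℕ; zero; suc; NonZero)
open import Data.Product.Base using (_×_; _,_; proj₁; proj₂; ∃)
open import Data.Rational.Base as ℚ using (0ℚ; mkℚ)
import Data.Sign.Base as Sign
open import Data.Sum.Base using (_⊎_; inj₁; inj₂; [_,_]′) renaming (map to map-⊎)
open import Data.Vec.Functional using (Vector)
open import Function.Base using (_∘_; id)
open import Relation.Binary.Bundles using (DecTotalOrder)
import Relation.Binary.Construct.NonStrictToStrict as ToStrict
open import Relation.Binary.Consequences using (dec⇒weaklyDec)
open import Relation.Binary.PropositionalEquality.Core as ≡ using ()
open import Relation.Nullary.Decidable.Core using (Dec; yes; no; toSum)
open import Relation.Nullary.Decidable using (_×-dec_)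
open import Relation.Nullary.Negation.Core using (¬_)

module RoundRobin {c ℓ₁ ℓ₂} (R : RealNumbers c ℓ₁ ℓ₂) where

  open RealNumbers R hiding (zero)

  private
    # = fromℕ

  -- Integers in the field and the ring solver

  open RingProperties ring using
    (-0#≈0#; -‿involutive; -‿+-comm; -‿distribˡ-*; -‿distribʳ-*)
  open Mult semiring using (×-homo-+; ×1-homo-*)
  open import Relation.Binary.Reasoning.Setoid setoid

  fromℤ-◃- : ∀ n → fromℤ (Sign.- ◃ n) ≈ - fromℕ n
  fromℤ-◃- zero    = sym -0#≈0#
  fromℤ-◃- (suc n) = refl

  fromℤ-homo-neg : ∀ i → fromℤ (ℤ.- i) ≈ - fromℤ i
  fromℤ-homo-neg (+ zero)  = sym -0#≈0#
  fromℤ-homo-neg (+ suc n) = refl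
  fromℤ-homo-neg -[1+ n ]  = sym (-‿involutive _)

  fromℤ-⊖ : ∀ m n → fromℤ (m ⊖ n) ≈ fromℕ m - fromℕ n
  fromℤ-⊖ m zero = sym (trans (+-congˡ -0#≈0#) (+-identityʳ _))
  fromℤ-⊖ zero (suc n) = sym (+-identityˡ _)
  fromℤ-⊖ (suc m) (suc n) = begin
    fromℤ (suc m ⊖ suc n)                     ≡⟨ ≡.cong fromℤ (ℤ.[1+m]⊖[1+n]≡m⊖n m n) ⟩
    fromℤ (m ⊖ n)                             ≈⟨ fromℤ-⊖ m n ⟩
    fromℕ m - fromℕ n                         ≈⟨ +-congʳ (+-identityˡ _) ⟨
    0# + fromℕ m - fromℕ n                    ≈⟨ +-congʳ (+-congʳ (-‿inverseʳ 1#)) ⟨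
    1# - 1# + fromℕ m - fromℕ n               ≈⟨ +-congʳ (+-assoc _ _ _) ⟩
    1# + (- 1# + fromℕ m) - fromℕ n           ≈⟨ +-congʳ (+-congˡ (+-comm _ _)) ⟩
    1# + (fromℕ m - 1#) - fromℕ n             ≈⟨ +-congʳ (+-assoc _ _ _) ⟨
    fromℕ (suc m) - 1# - fromℕ n              ≈⟨ +-assoc _ _ _ ⟩
    fromℕ (suc m) + (- 1# - fromℕ n)          ≈⟨ +-congˡ (-‿+-comm _ _) ⟩
    fromℕ (suc m) - fromℕ (suc n)             ∎

  fromℤ-homo-+ : ∀ i j → fromℤ (i ℤ.+ j) ≈ fromℤ i + fromℤ j
  fromℤ-homo-+ (+ m)    (+ n)    = ×-homo-+ 1# m n
  fromℤ-homo-+ (+ m)    -[1+ n ] = fromℤ-⊖ m (suc n)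
  fromℤ-homo-+ -[1+ m ] (+ n)    = trans (fromℤ-⊖ n (suc m)) (+-comm _ _)
  fromℤ-homo-+ -[1+ m ] -[1+ n ] = begin
    - fromℕ (suc (suc (m ℕ.+ n)))     ≈⟨ -‿cong (+-congˡ (×-homo-+ 1# (suc m) n)) ⟩
    - (1# + (fromℕ (suc m) + fromℕ n)) ≈⟨ -‿cong (+-assoc _ _ _) ⟨
    - (1# + fromℕ (suc m) + fromℕ n)   ≈⟨ -‿cong (+-congʳ (+-comm _ _)) ⟩
    - (fromℕ (suc m) + 1# + fromℕ n)   ≈⟨ -‿cong (+-assoc _ _ _) ⟩
    - (fromℕ (suc m) + fromℕ (suc n))  ≈⟨ -‿+-comm _ _ ⟨
    - fromℕ (suc m) - fromℕ (suc n)    ∎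

  fromℤ-homo-* : ∀ i j → fromℤ (i ℤ.* j) ≈ fromℤ i * fromℤ j
  fromℤ-homo-* (+ m) (+ n) =
    trans (reflexive (≡.cong fromℤ (ℤ.+◃n≡+n (m ℕ.* n)))) (×1-homo-* m n)
  fromℤ-homo-* (+ m) -[1+ n ] = begin
    fromℤ (Sign.- ◃ m ℕ.* suc n)  ≈⟨ fromℤ-◃- (m ℕ.* suc n) ⟩
    - fromℕ (m ℕ.* suc n)         ≈⟨ -‿cong (×1-homo-* m (suc n)) ⟩
    - (fromℕ m * fromℕ (suc n))   ≈⟨ -‿distribʳ-* _ _ ⟩
    fromℕ m * - fromℕ (suc n)     ∎
  fromℤ-homo-* -[1+ m ] (+ n) = begin
    fromℤ (Sign.- ◃ suc m ℕ.* n)  ≈⟨ fromℤ-◃- (suc m ℕ.* n) ⟩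
    - fromℕ (suc m ℕ.* n)         ≈⟨ -‿cong (×1-homo-* (suc m) n) ⟩
    - (fromℕ (suc m) * fromℕ n)   ≈⟨ -‿distribˡ-* _ _ ⟩
    - fromℕ (suc m) * fromℕ n     ∎
  fromℤ-homo-* -[1+ m ] -[1+ n ] = begin
    fromℕ (suc m ℕ.* suc n)               ≈⟨ ×1-homo-* (suc m) (suc n) ⟩
    fromℕ (suc m) * fromℕ (suc n)         ≈⟨ -‿involutive _ ⟨
    - - (fromℕ (suc m) * fromℕ (suc n))   ≈⟨ -‿cong (-‿distribʳ-* _ _) ⟩
    - (fromℕ (suc m) * - fromℕ (suc n))   ≈⟨ -‿distribˡ-* _ _ ⟩
    - fromℕ (suc m) * - fromℕ (suc n)     ∎

  -- fromℤ (+ 1) unfolds to 1# + 0#; the solver should read con (+ 1) as 1#.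
  coefficient : ℤ → Carrier
  coefficient (+ 1) = 1#
  coefficient i     = fromℤ i

  coefficient≈fromℤ : ∀ i → coefficient i ≈ fromℤ i
  coefficient≈fromℤ (+ 0)             = refl
  coefficient≈fromℤ (+ 1)             = sym (+-identityʳ 1#)
  coefficient≈fromℤ (+ suc (suc n))   = refl
  coefficient≈fromℤ -[1+ n ]          = refl

  -- The solver normalises over ℤ, where arithmetic computes and equality is decided by evaluation,
  -- so numerals such as `# 9` can occur in the identities it proves.
  coefficient-morphism :
    ℤ.+-*-rawRing -Raw-AlmostCommutative⟶ fromCommutativeRing commutativeRing
  coefficient-morphism = record
    { ⟦_⟧    = coefficient
    ; +-homo = λ i j → trans (coefficient≈fromℤ (i ℤ.+ j)) (trans (fromℤ-homo-+ i j)
                 (sym (+-cong (coefficient≈fromℤ i) (coefficient≈fromℤ j))))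
    ; *-homo = λ i j → trans (coefficient≈fromℤ (i ℤ.* j)) (trans (fromℤ-homo-* i j)
                 (sym (*-cong (coefficient≈fromℤ i) (coefficient≈fromℤ j))))
    ; -‿homo = λ i → trans (coefficient≈fromℤ (ℤ.- i)) (trans (fromℤ-homo-neg i)
                 (sym (-‿cong (coefficient≈fromℤ i))))
    ; 0-homo = refl
    ; 1-homo = refl
    }

  open RingSolver ℤ.+-*-rawRing (fromCommutativeRing commutativeRing) coefficient-morphism
    (λ i j → map (reflexive ∘ ≡.cong coefficient) (dec⇒weaklyDec ℤ._≟_ i j))
    using (Polynomial; solve; _:=_; _:+_; _:*_; _:-_; :-_; con)

  :# : ∀ {m} → ℕ → Polynomial m
  :# n = con (+ n)

  -- Ordered field arithmetic

  open DecTotalOrder decTotalOrder using (_≤?_; _≟_)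
    renaming ( refl to ≤-refl; reflexive to ≤-reflexive; trans to ≤-trans
             ; antisym to ≤-antisym; total to ≤-total
             ; ≤-respˡ-≈ to ≤-respˡ; ≤-respʳ-≈ to ≤-respʳ)
  open ToStrict _≈_ _≤_ using (<⇒≤; <-≤-trans; ≤-<-trans; <⇒≱; <-decidable)
  open NaturalMin (DecTotalOrder.totalOrder decTotalOrder)
    using (_⊓_; x≤y⇒x⊓y≈x; x≤y⇒y⊓x≈x; x⊓y≤x; x⊓y≤y; ⊓-monoˡ-≤)
  open NaturalMax (DecTotalOrder.totalOrder decTotalOrder)
    using (x≤y⇒x⊔y≈y; x≤y⇒y⊔x≈y; x≤x⊔y; x≤y⊔x; ⊔-monoʳ-≤; ⊔-monoˡ-≤; ⊔-congˡ; ⊔-lub)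

  ≤⇒0≤- : ∀ {x y} → x ≤ y → 0# ≤ y - x
  ≤⇒0≤- {x} {y} x≤y = ≤-respˡ (-‿inverseˡ x) (≤-respʳ (+-comm _ _) (+-monoʳ-≤ (- x) x≤y))

  -- Turns an inequality into a certificate: a nonnegative `d` together with a ring identity for the
  -- solver. Most inequalities below are proved in this way.
  ≤-from-diff : ∀ {x y d} → 0# ≤ d → y - x ≈ d → x ≤ y
  ≤-from-diff {x} {y} 0≤d y-x≈d = ≤-respˡ (+-identityʳ x)
    (≤-respʳ (trans (+-congˡ (sym y-x≈d))
                    (solve 2 (λ x y → x :+ (y :- x) := y) refl x y))
             (+-monoʳ-≤ x 0≤d))

  +-nonneg : ∀ {x y} → 0# ≤ x → 0# ≤ y → 0# ≤ x + y
  +-nonneg 0≤x 0≤y = ≤-trans 0≤x (≤-respˡ (+-identityʳ _) (+-monoʳ-≤ _ 0≤y))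

  +-mono-≤ : ∀ {x y u v} → x ≤ y → u ≤ v → x + u ≤ y + v
  +-mono-≤ {x} {y} {u} {v} x≤y u≤v =
    ≤-from-diff (+-nonneg (≤⇒0≤- x≤y) (≤⇒0≤- u≤v))
      (solve 4 (λ x y u v → y :+ v :- (x :+ u) := y :- x :+ (v :- u)) refl x y u v)

  *-monoʳ-≤ : ∀ {z x y} → 0# ≤ z → x ≤ y → z * x ≤ z * y
  *-monoʳ-≤ {z} {x} {y} 0≤z x≤y = ≤-from-diff (*-nonneg 0≤z (≤⇒0≤- x≤y))
    (solve 3 (λ x y z → z :* y :- z :* x := z :* (y :- x)) refl x y z)

  -‿anti-≤ : ∀ {x y} → x ≤ y → - y ≤ - x
  -‿anti-≤ {x} {y} x≤y = ≤-from-diff (≤⇒0≤- x≤y)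
    (solve 2 (λ x y → :- x :- (:- y) := y :- x) refl x y)

  ≤⇒0≤neg : ∀ {x} → x ≤ 0# → 0# ≤ - x
  ≤⇒0≤neg x≤0 = ≤-respʳ (+-identityˡ _) (≤⇒0≤- x≤0)

  square-nonneg : ∀ x → 0# ≤ x * x
  square-nonneg x with ≤-total 0# x
  ... | inj₁ 0≤x = *-nonneg 0≤x 0≤x
  ... | inj₂ x≤0 = ≤-respʳ (solve 1 (λ x → (:# 0 :- x) :* (:# 0 :- x) := x :* x) refl x)
                     (*-nonneg (≤⇒0≤- x≤0) (≤⇒0≤- x≤0))

  0≤1 : 0# ≤ 1#
  0≤1 = ≤-respʳ (*-identityˡ 1#) (square-nonneg 1#)

  fromℕ-nonneg : ∀ n → 0# ≤ fromℕ n
  fromℕ-nonneg zero    = ≤-refl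
  fromℕ-nonneg (suc n) = +-nonneg 0≤1 (fromℕ-nonneg n)

  0<fromℕ-suc : ∀ n → 0# < fromℕ (suc n)
  0<fromℕ-suc n = fromℕ-nonneg (suc n) , λ 0≈1+n →
    0≉1 (≤-antisym 0≤1 (≤-respʳ (sym 0≈1+n)
      (≤-respˡ (+-identityʳ 1#) (+-monoʳ-≤ 1# (fromℕ-nonneg n)))))

  *-⁻¹ : ∀ {x} → 0# < x → x * x ⁻¹ ≈ 1#
  *-⁻¹ (_ , 0≉x) = ⁻¹-inverseʳ (0≉x ∘ sym)

  -- `x ⁻¹` equals `x` times the square of `x ⁻¹`.
  ⁻¹-nonneg : ∀ {x} → 0# < x → 0# ≤ x ⁻¹
  ⁻¹-nonneg {x} 0<x = ≤-respʳ
    (trans (sym (*-assoc _ _ _)) (trans (*-congʳ (*-⁻¹ 0<x)) (*-identityˡ _)))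
    (*-nonneg (<⇒≤ 0<x) (square-nonneg (x ⁻¹)))

  *-cancelˡ-≤ : ∀ {z x y} → 0# < z → z * x ≤ z * y → x ≤ y
  *-cancelˡ-≤ {z} {x} {y} 0<z zx≤zy =
    ≤-from-diff (*-nonneg (⁻¹-nonneg 0<z) (≤⇒0≤- zx≤zy)) (begin
      y - x                      ≈⟨ *-identityˡ _ ⟨
      1# * (y - x)               ≈⟨ *-congʳ (*-⁻¹ 0<z) ⟨
      z * z ⁻¹ * (y - x)         ≈⟨ solve 4 (λ x y z w → z :* w :* (y :- x) := w :* (z :* y :- z :* x))
                                      refl x y z (z ⁻¹) ⟩
      z ⁻¹ * (z * y - z * x)     ∎)

  fromℤ-nonneg : ∀ i .{{_ : ℤ.NonNegative i}} → 0# ≤ fromℤ i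
  fromℤ-nonneg (+ n) = fromℕ-nonneg n

  fromℚ-nonneg : ∀ {q} → 0ℚ ℚ.≤ q → 0# ≤ fromℚ q
  fromℚ-nonneg {mkℚ i d _} 0≤q =
    *-nonneg (fromℤ-nonneg i {{ℚ.nonNegative 0≤q}}) (⁻¹-nonneg (0<fromℕ-suc d))

  ≰⇒≥ : ∀ {x y} → ¬ x ≤ y → y ≤ x
  ≰⇒≥ {x} {y} x≰y with ≤-total x y
  ... | inj₁ x≤y = ⊥-elim (x≰y x≤y)
  ... | inj₂ y≤x = y≤x

  _<?_ : ∀ x y → Dec (x < y)
  _<?_ = <-decidable _≟_ _≤?_

  <⇒≰ : ∀ {x y} → x < y → ¬ y ≤ x
  <⇒≰ = <⇒≱ ≤-antisym

  <-≤-trans′ : ∀ {x y z} → x < y → y ≤ z → x < z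
  <-≤-trans′ = <-≤-trans sym ≤-trans ≤-antisym ≤-respʳ

  ≤-<-trans′ : ∀ {x y z} → x ≤ y → y < z → x < z
  ≤-<-trans′ = ≤-<-trans ≤-trans ≤-antisym ≤-respˡ

  double-cancel-≈ : ∀ {x y} → fromℕ 2 * x ≈ x + y → x ≈ y
  double-cancel-≈ {x} {y} 2x≈x+y = begin
    x                    ≈⟨ solve 1 (λ x → x := :# 2 :* x :- x) refl x ⟩
    fromℕ 2 * x - x      ≈⟨ +-congʳ 2x≈x+y ⟩
    x + y - x            ≈⟨ solve 2 (λ x y → x :+ y :- x := y) refl x y ⟩
    y                    ∎

  dense : ∀ {x y} → x < y → ∃ λ m → x < m × m < y
  dense {x} {y} x<y = m , (x≤m , x≉m) , (m≤y , m≉y)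
    where
    m = (x + y) / fromℕ 2
    2m≈x+y : fromℕ 2 * m ≈ x + y
    2m≈x+y = begin
      fromℕ 2 * m                      ≈⟨ solve 3 (λ x y w → :# 2 :* ((x :+ y) :* w) := :# 2 :* w :* (x :+ y))
                                            refl x y (fromℕ 2 ⁻¹) ⟩
      fromℕ 2 * fromℕ 2 ⁻¹ * (x + y)   ≈⟨ *-congʳ (*-⁻¹ (0<fromℕ-suc 1)) ⟩
      1# * (x + y)                     ≈⟨ *-identityˡ _ ⟩
      x + y                            ∎
    x≤m : x ≤ m
    x≤m = *-cancelˡ-≤ (0<fromℕ-suc 1) (≤-respʳ (sym 2m≈x+y) (≤-from-diff (≤⇒0≤- (<⇒≤ x<y))
            (solve 2 (λ x y → x :+ y :- :# 2 :* x := y :- x) refl x y)))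
    m≤y : m ≤ y
    m≤y = *-cancelˡ-≤ (0<fromℕ-suc 1) (≤-respˡ (sym 2m≈x+y) (≤-from-diff (≤⇒0≤- (<⇒≤ x<y))
            (solve 2 (λ x y → :# 2 :* y :- (x :+ y) := y :- x) refl x y)))
    x≉m : ¬ x ≈ m
    x≉m x≈m = proj₂ x<y (double-cancel-≈ (trans (*-congˡ x≈m) 2m≈x+y))
    m≉y : ¬ m ≈ y
    m≉y m≈y = proj₂ x<y (sym (double-cancel-≈
      (trans (*-congˡ (sym m≈y)) (trans 2m≈x+y (+-comm x y)))))

  -- Finite sums

  open Sum semiring using (∑-distrib-+; sum-cong-≋; *-distribˡ-sum)

  sum-nonneg : ∀ {n} {f : Vector Carrier n} → (∀ i → 0# ≤ f i) → 0# ≤ sum f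
  sum-nonneg {zero}  0≤f = ≤-refl
  sum-nonneg {suc n} 0≤f = +-nonneg (0≤f zero) (sum-nonneg (0≤f ∘ suc))

  sum-mono-≤ : ∀ {n} {f g : Vector Carrier n} → (∀ i → f i ≤ g i) → sum f ≤ sum g
  sum-mono-≤ {zero}  f≤g = ≤-refl
  sum-mono-≤ {suc n} f≤g = +-mono-≤ (f≤g zero) (sum-mono-≤ (f≤g ∘ suc))

  term≤sum : ∀ {n} {f : Vector Carrier n} → (∀ i → 0# ≤ f i) → ∀ i → f i ≤ sum f
  term≤sum {suc n} 0≤f zero = ≤-respˡ (+-identityʳ _) (+-monoʳ-≤ _ (sum-nonneg (0≤f ∘ suc)))
  term≤sum {suc n} 0≤f (suc i) =
    ≤-respˡ (+-identityˡ _) (+-mono-≤ (0≤f zero) (term≤sum (0≤f ∘ suc) i))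

  -- Monotone functions and weighted interval covers

  Monotone : (Carrier → Carrier) → Set _
  Monotone G = ∀ {x y} → x ≤ y → G x ≤ G y

  Monotone⇒cong : ∀ {G} → Monotone G → ∀ {x y} → x ≈ y → G x ≈ G y
  Monotone⇒cong mono x≈y = ≤-antisym (mono (≤-reflexive x≈y)) (mono (≤-reflexive (sym x≈y)))

  -- The minimum and the maximum are `x` and `C` in some order. Hence the increments of `G`
  -- truncated above `C` and of `G` truncated below `C` add up to the increment of `G` over any
  -- interval.
  min-max-sum : ∀ {G} → Monotone G → ∀ C x → G (x ⊓ C) + G (max x C) ≈ G x + G C
  min-max-sum {G} mono C x = [ below , above ]′ (≤-total x C)
    where
    cong = Monotone⇒cong {G} mono
    below : x ≤ C → G (x ⊓ C) + G (max x C) ≈ G x + G C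
    below x≤C = +-cong (cong (x≤y⇒x⊓y≈x x≤C)) (cong (x≤y⇒x⊔y≈y x≤C))
    above : C ≤ x → G (x ⊓ C) + G (max x C) ≈ G x + G C
    above C≤x = trans (+-cong (cong (x≤y⇒y⊓x≈x C≤x)) (cong (x≤y⇒y⊔x≈y C≤x))) (+-comm _ _)

  module _ {n} (w l h : Vector Carrier n) where

    -- Formally the Stieltjes integral, against dG, of the step function that sums the weights of
    -- the intervals containing a point.
    Stieltjes-sum : (Carrier → Carrier) → Carrier
    Stieltjes-sum G = sum λ i → w i * (G (h i) - G (l i))

    -- `G` is quantified inside because `Bound-split` uses the two partial bounds at different
    -- truncations of `G`.
    Bound : Carrier → Carrier → Carrier → Set _
    Bound K A B = ∀ {G} → Monotone G → K * (G B - G A) ≤ Stieltjes-sum G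

    -- The bound on (A , C) is applied to `G` frozen above `C`, the bound on (C , B) to `G` frozen
    -- below `C`. The function is cut instead of the intervals, so the family stays the same.
    Bound-split : ∀ {K A C B} → A ≤ C → C ≤ B → Bound K A C → Bound K C B → Bound K A B
    Bound-split {K} {A} {C} {B} A≤C C≤B boundˡ boundʳ {G} mono =
      ≤-respˡ left (≤-respʳ right (+-mono-≤ (boundˡ {G₁} mono₁) (boundʳ {G₂} mono₂)))
      where
      G₁ G₂ : Carrier → Carrier
      G₁ x = G (x ⊓ C)
      G₂ x = G (max x C)
      mono₁ : Monotone G₁
      mono₁ = mono ∘ ⊓-monoˡ-≤ C
      mono₂ : Monotone G₂
      mono₂ = mono ∘ ⊔-monoˡ-≤ C
      cong = Monotone⇒cong {G} mono
      left : K * (G₁ C - G₁ A) + K * (G₂ B - G₂ C) ≈ K * (G B - G A)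
      left = begin
        K * (G₁ C - G₁ A) + K * (G₂ B - G₂ C)
          ≈⟨ +-cong (*-congˡ (+-cong (cong (x≤y⇒x⊓y≈x ≤-refl)) (-‿cong (cong (x≤y⇒x⊓y≈x A≤C)))))
                    (*-congˡ (+-cong (cong (x≤y⇒y⊔x≈y C≤B)) (-‿cong (cong (x≤y⇒y⊔x≈y ≤-refl))))) ⟩
        K * (G C - G A) + K * (G B - G C)
          ≈⟨ solve 4 (λ k a b c → k :* (c :- a) :+ k :* (b :- c) := k :* (b :- a)) refl
               K (G A) (G B) (G C) ⟩
        K * (G B - G A) ∎
      term : ∀ i → w i * (G₁ (h i) - G₁ (l i)) + w i * (G₂ (h i) - G₂ (l i)) ≈
                   w i * (G (h i) - G (l i))
      term i = begin
        w i * (G₁ (h i) - G₁ (l i)) + w i * (G₂ (h i) - G₂ (l i))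
          ≈⟨ solve 5 (λ w a b c d → w :* (a :- b) :+ w :* (c :- d) := w :* (a :+ c :- (b :+ d)))
               refl (w i) (G₁ (h i)) (G₁ (l i)) (G₂ (h i)) (G₂ (l i)) ⟩
        w i * (G₁ (h i) + G₂ (h i) - (G₁ (l i) + G₂ (l i)))
          ≈⟨ *-congˡ (+-cong (min-max-sum {G} mono C (h i)) (-‿cong (min-max-sum {G} mono C (l i)))) ⟩
        w i * (G (h i) + G C - (G (l i) + G C))
          ≈⟨ solve 4 (λ w a b c → w :* (a :+ c :- (b :+ c)) := w :* (a :- b))
               refl (w i) (G (h i)) (G (l i)) (G C) ⟩
        w i * (G (h i) - G (l i)) ∎
      right : Stieltjes-sum G₁ + Stieltjes-sum G₂ ≈ Stieltjes-sum G
      right = trans (sym (∑-distrib-+ (λ i → w i * (G₁ (h i) - G₁ (l i)))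
                                      (λ i → w i * (G₂ (h i) - G₂ (l i)))))
                    (sum-cong-≋ term)

  -- Cutting (A , B) at the endpoints of the first interval leaves pieces on which that
  -- interval is either irrelevant or total; in the latter case it lowers K by w zero.
  interval-cover : ∀ {n} {l h w : Vector Carrier n} {φ : Fin n → Carrier → Carrier} →
    (∀ i → l i ≤ h i) → (∀ i → 0# ≤ w i) → (∀ i t → φ i t ≤ w i) →
    (∀ i t → ¬ (t ∈[ l i , h i ]) → φ i t ≤ 0#) →
    ∀ {K A B} → A ≤ B → (∀ t → A < t → t < B → K ≤ sum λ i → φ i t) → Bound w l h K A B
  interval-cover {zero} l≤h 0≤w φ≤w φ-out {K} {A} {B} A≤B K≤φ {G} mono with A ≟ B
  ... | yes A≈B = ≤-reflexive (begin
    K * (G B - G A)  ≈⟨ *-congˡ (+-congʳ (Monotone⇒cong {G} mono (sym A≈B))) ⟩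
    K * (G A - G A)  ≈⟨ solve 2 (λ k a → k :* (a :- a) := :# 0) refl K (G A) ⟩
    0#               ∎)
  -- With no interval left the total weight is the empty sum, so a single test point inside (A , B)
  -- forces `K ≤ 0`.
  ... | no A≉B = let t , A<t , t<B = dense (A≤B , A≉B) in
    ≤-from-diff (*-nonneg (≤⇒0≤- (K≤φ t A<t t<B)) (≤⇒0≤- (mono A≤B)))
      (solve 3 (λ k a b → :# 0 :- k :* (b :- a) := (:# 0 :- k) :* (b :- a)) refl K (G A) (G B))
  interval-cover {suc n} {l} {h} {w} {φ} l≤h 0≤w φ≤w φ-out = cut-l
    where
    l₀ = l zero
    h₀ = h zero
    w₀ = w zero

    Covered : Carrier → Carrier → Carrier → Set _
    Covered K A B = ∀ t → A < t → t < B → K ≤ sum λ i → φ i t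

    tail-cover : ∀ {K A B} → A ≤ B → (∀ t → A < t → t < B → K ≤ sum λ i → φ (suc i) t) →
                 Bound (w ∘ suc) (l ∘ suc) (h ∘ suc) K A B
    tail-cover = interval-cover (l≤h ∘ suc) (0≤w ∘ suc) (φ≤w ∘ suc) (φ-out ∘ suc)

    -- `φ zero` is at most 0 throughout (A , B), so the other intervals carry the level `K` alone,
    -- while the first adds a nonnegative term to the sum.
    disjoint : ∀ {K A B} → A ≤ B → (∀ t → A < t → t < B → ¬ (t ∈[ l₀ , h₀ ])) →
               Covered K A B → Bound w l h K A B
    disjoint A≤B out K≤φ {G} mono = ≤-respˡ (+-identityˡ _)
      (+-mono-≤ (*-nonneg (0≤w zero) (≤⇒0≤- (mono (l≤h zero))))
        (tail-cover A≤B (λ t A<t t<B → ≤-trans (K≤φ t A<t t<B)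
          (≤-respʳ (+-identityˡ _) (+-mono-≤ (φ-out zero t (out t A<t t<B)) ≤-refl)))
          {G} mono))

    spanning : ∀ {K A B} → A ≤ B → l₀ ≤ A → B ≤ h₀ → Covered K A B → Bound w l h K A B
    spanning {K} {A} {B} A≤B l₀≤A B≤h₀ K≤φ {G} mono =
      ≤-from-diff
        -- Three sources of slack: the tail bound at level `K - w₀`, and the growth of `G` over the
        -- parts of the first interval right of `B` and left of `A`.
        (+-nonneg (≤⇒0≤- (tail-cover {K - w₀} A≤B rest {G} mono))
          (+-nonneg (*-nonneg (0≤w zero) (≤⇒0≤- (mono B≤h₀)))
                    (*-nonneg (0≤w zero) (≤⇒0≤- (mono l₀≤A)))))
        (solve 7 (λ k w a b p q s →
            w :* (q :- p) :+ s :- k :* (b :- a) :=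
            s :- (k :- w) :* (b :- a) :+ (w :* (q :- b) :+ w :* (a :- p)))
          refl K w₀ (G A) (G B) (G l₀) (G h₀) _)
      where
      rest : ∀ t → A < t → t < B → K - w₀ ≤ sum λ i → φ (suc i) t
      rest t A<t t<B =
        ≤-from-diff (≤⇒0≤- (≤-trans (K≤φ t A<t t<B) (+-mono-≤ (φ≤w zero t) ≤-refl)))
          (solve 3 (λ k w s → s :- (k :- w) := w :+ s :- k) refl K w₀ _)

    no-cut : ∀ {K A B} → A ≤ B → l₀ ≤ A ⊎ B ≤ l₀ → h₀ ≤ A ⊎ B ≤ h₀ →
             Covered K A B → Bound w l h K A B
    no-cut A≤B (inj₂ B≤l₀) _ =
      disjoint A≤B (λ t _ t<B (l₀≤t , _) → <⇒≰ t<B (≤-trans B≤l₀ l₀≤t))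
    no-cut A≤B (inj₁ _) (inj₁ h₀≤A) =
      disjoint A≤B (λ t A<t _ (_ , t≤h₀) → <⇒≰ A<t (≤-trans t≤h₀ h₀≤A))
    no-cut A≤B (inj₁ l₀≤A) (inj₂ B≤h₀) = spanning A≤B l₀≤A B≤h₀

    cut-h : ∀ {K A B} → A ≤ B → l₀ ≤ A ⊎ B ≤ l₀ → Covered K A B → Bound w l h K A B
    cut-h {A = A} {B} A≤B l₀-out K≤φ with ≤-total h₀ A | ≤-total B h₀
    ... | inj₁ h₀≤A | _         = no-cut A≤B l₀-out (inj₁ h₀≤A) K≤φ
    ... | inj₂ _    | inj₁ B≤h₀ = no-cut A≤B l₀-out (inj₂ B≤h₀) K≤φ
    ... | inj₂ A≤h₀ | inj₂ h₀≤B = Bound-split w l h A≤h₀ h₀≤B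
      (no-cut A≤h₀ (map-⊎ id (≤-trans h₀≤B) l₀-out) (inj₂ ≤-refl)
        (λ t A<t t<h₀ → K≤φ t A<t (<-≤-trans′ t<h₀ h₀≤B)))
      (no-cut h₀≤B (map-⊎ (λ l₀≤A → ≤-trans l₀≤A A≤h₀) id l₀-out) (inj₁ ≤-refl)
        (λ t h₀<t t<B → K≤φ t (≤-<-trans′ A≤h₀ h₀<t) t<B))

    cut-l : ∀ {K A B} → A ≤ B → Covered K A B → Bound w l h K A B
    cut-l {A = A} {B} A≤B K≤φ with ≤-total l₀ A | ≤-total B l₀
    ... | inj₁ l₀≤A | _         = cut-h A≤B (inj₁ l₀≤A) K≤φ
    ... | inj₂ _    | inj₁ B≤l₀ = cut-h A≤B (inj₂ B≤l₀) K≤φ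
    ... | inj₂ A≤l₀ | inj₂ l₀≤B = Bound-split w l h A≤l₀ l₀≤B
      (cut-h A≤l₀ (inj₂ ≤-refl) (λ t A<t t<l₀ → K≤φ t A<t (<-≤-trans′ t<l₀ l₀≤B)))
      (cut-h l₀≤B (inj₁ ≤-refl) (λ t l₀<t t<B → K≤φ t (≤-<-trans′ A≤l₀ l₀<t) t<B))

  -- The potential and its spread bound

  clamp : Carrier → Carrier
  clamp y = max 0# (y ⊓ 1#)

  clamp≤1 : ∀ y → clamp y ≤ 1#
  clamp≤1 y = ⊔-lub 0≤1 (x⊓y≤y y 1#)

  clamp-mono : Monotone clamp
  clamp-mono = ⊔-monoʳ-≤ 0# ∘ ⊓-monoˡ-≤ 1#

  -- Clamping gives the nonnegative half of the potential by one formula: 0 up to 0, then y (4 - y),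
  -- then 3 from 1 on. `potential` glues it to its mirror image.
  profile : Carrier → Carrier
  profile y = clamp y * (# 4 - clamp y)

  profile-mono : Monotone profile
  profile-mono {x} {y} x≤y =
    -- The difference factors as (t - s) (4 - s - t), and clamped values leave the second factor at
    -- least 2.
    ≤-from-diff (*-nonneg (≤⇒0≤- (clamp-mono x≤y))
                  (+-nonneg (+-nonneg (≤⇒0≤- (clamp≤1 x)) (≤⇒0≤- (clamp≤1 y))) (fromℕ-nonneg 2)))
      (solve 2 (λ s t → t :* (:# 4 :- t) :- s :* (:# 4 :- s) :=
                        (t :- s) :* (:# 1 :- s :+ (:# 1 :- t) :+ :# 2))
        refl (clamp x) (clamp y))

  profile-at : ∀ {y s} → clamp y ≈ s → profile y ≈ s * (# 4 - s)
  profile-at c≈s = *-cong c≈s (+-congˡ (-‿cong c≈s))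

  profile-≤0 : ∀ {y} → y ≤ 0# → profile y ≈ 0#
  profile-≤0 {y} y≤0 =
    trans (profile-at (x≤y⇒y⊔x≈y (≤-trans (x⊓y≤x y 1#) y≤0))) (zeroˡ _)

  profile-mid : ∀ {y} → 0# ≤ y → y ≤ 1# → profile y ≈ y * (# 4 - y)
  profile-mid 0≤y y≤1 = profile-at
    (trans (⊔-congˡ 0# (x≤y⇒x⊓y≈x y≤1)) (x≤y⇒x⊔y≈y 0≤y))

  profile-≥1 : ∀ {y} → 1# ≤ y → profile y ≈ # 3
  profile-≥1 1≤y = trans
    (profile-at (trans (⊔-congˡ 0# (x≤y⇒y⊓x≈x 1≤y)) (x≤y⇒x⊔y≈y 0≤1)))
    (solve 0 (:# 1 :* (:# 4 :- :# 1) := :# 3) refl)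

  potential : Carrier → Carrier
  potential v = profile v - profile (- v)

  potential-mono : Monotone potential
  potential-mono x≤y = +-mono-≤ (profile-mono x≤y) (-‿anti-≤ (profile-mono (-‿anti-≤ x≤y)))

  potential-cong : ∀ {x y} → x ≈ y → potential x ≈ potential y
  potential-cong = Monotone⇒cong {potential} potential-mono

  potential-odd : ∀ v → potential (- v) ≈ - potential v
  potential-odd v = trans
    (+-congˡ (-‿cong (Monotone⇒cong {profile} profile-mono (-‿involutive v))))
    (solve 2 (λ p q → q :- p := :- (p :- q)) refl (profile v) (profile (- v)))

  neg≤0 : ∀ {v} → 0# ≤ v → - v ≤ 0#
  neg≤0 0≤v = ≤-respʳ -0#≈0# (-‿anti-≤ 0≤v)

  potential-nonneg : ∀ {v} → 0# ≤ v → potential v ≈ profile v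
  potential-nonneg {v} 0≤v = trans (+-congˡ (-‿cong (profile-≤0 (neg≤0 0≤v))))
    (solve 1 (λ p → p :- :# 0 := p) refl (profile v))

  potential-mid : ∀ {v} → 0# ≤ v → v ≤ 1# → potential v ≈ v * (# 4 - v)
  potential-mid 0≤v v≤1 = trans (potential-nonneg 0≤v) (profile-mid 0≤v v≤1)

  potential-≥1 : ∀ {v} → 1# ≤ v → potential v ≈ # 3
  potential-≥1 1≤v = trans (potential-nonneg (≤-trans 0≤1 1≤v)) (profile-≥1 1≤v)

  potential-neg-mid : ∀ {v} → 0# ≤ - v → - v ≤ 1# → potential v ≈ v * (# 4 + v)
  potential-neg-mid {v} 0≤-v -v≤1 = begin
    potential v                  ≈⟨ -‿involutive _ ⟨
    - - potential v              ≈⟨ -‿cong (potential-odd v) ⟨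
    - potential (- v)            ≈⟨ -‿cong (potential-mid 0≤-v -v≤1) ⟩
    - (- v * (# 4 - - v))        ≈⟨ solve 1 (λ v → :- (:- v :* (:# 4 :- :- v)) := v :* (:# 4 :+ v))
                                      refl v ⟩
    v * (# 4 + v)                ∎

  -- Tight at σ = n = 1/2, i.e. for sensors at 1/4 and 3/4 of radius 1/4.  In every case the
  -- difference of the two sides is written as a sum of products of nonnegative terms.
  spread-bound : ∀ {n σ} → 0# ≤ n → n ≤ 1# → 0# ≤ σ →
    (1# + n) * (potential (σ - n) + potential (σ + n)) ≤ # 9 * σ
  spread-bound {n} {σ} 0≤n n≤1 0≤σ =
    by-cases (≤-total 1# (σ - n)) (≤-total 0# (σ - n)) (≤-total 1# (σ + n))
    where
    at : ∀ {p q} → potential (σ - n) ≈ p → potential (σ + n) ≈ q →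
         (1# + n) * (p + q) ≤ # 9 * σ →
         (1# + n) * (potential (σ - n) + potential (σ + n)) ≤ # 9 * σ
    at ≈p ≈q = ≤-respˡ (*-congˡ (+-cong (sym ≈p) (sym ≈q)))

    0≤σ+n : 0# ≤ σ + n
    0≤σ+n = +-nonneg 0≤σ 0≤n

    σ-n≤σ+n : σ - n ≤ σ + n
    σ-n≤σ+n = ≤-from-diff (+-nonneg 0≤n 0≤n)
      (solve 2 (λ n s → s :+ n :- (s :- n) := n :+ n) refl n σ)

    -- So `σ - n` never goes below -1, where the potential is constant again. Three ranges for
    -- `σ - n` and two for `σ + n` remain; the top range of the former decides the latter, which
    -- makes five cases.
    -[σ-n]≤1 : - (σ - n) ≤ 1#
    -[σ-n]≤1 = ≤-from-diff (+-nonneg (≤⇒0≤- n≤1) 0≤σ)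
      (solve 2 (λ n s → :# 1 :- (:- (s :- n)) := :# 1 :- n :+ s) refl n σ)

    -- Writing `n` and `σ` through `σ - n` and `σ + n` produces halves; doubling clears them, so
    -- integer coefficients suffice in the certificates.
    2*≤ : ∀ {x y d} → 0# ≤ d → # 2 * y - # 2 * x ≈ d → x ≤ y
    2*≤ 0≤d eq = *-cancelˡ-≤ (0<fromℕ-suc 1) (≤-from-diff 0≤d eq)

    by-cases : 1# ≤ σ - n ⊎ σ - n ≤ 1# → 0# ≤ σ - n ⊎ σ - n ≤ 0# → 1# ≤ σ + n ⊎ σ + n ≤ 1# →
      (1# + n) * (potential (σ - n) + potential (σ + n)) ≤ # 9 * σ
    by-cases (inj₁ 1≤σ-n) _ _ =
      at (potential-≥1 1≤σ-n) (potential-≥1 (≤-trans 1≤σ-n σ-n≤σ+n))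
        (≤-from-diff (+-nonneg (*-nonneg (fromℕ-nonneg 6) (≤⇒0≤- 1≤σ-n))
                               (*-nonneg (fromℕ-nonneg 3) 0≤σ))
          (solve 2 (λ n s → :# 9 :* s :- (:# 1 :+ n) :* (:# 3 :+ :# 3) :=
                            :# 6 :* (s :- n :- :# 1) :+ :# 3 :* s) refl n σ))
    by-cases (inj₂ σ-n≤1) (inj₁ 0≤σ-n) (inj₂ σ+n≤1) =
      at (potential-mid 0≤σ-n σ-n≤1) (potential-mid 0≤σ+n σ+n≤1)
        (≤-from-diff (+-nonneg (*-nonneg 0≤σ (square-nonneg (1# - # 2 * n)))
                       (*-nonneg (*-nonneg (fromℕ-nonneg 2) (square-nonneg (σ - n)))
                                 (+-nonneg 0≤1 0≤n)))
          (solve 2 (λ n s →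
              :# 9 :* s :-
              (:# 1 :+ n) :* ((s :- n) :* (:# 4 :- (s :- n)) :+ (s :+ n) :* (:# 4 :- (s :+ n))) :=
              s :* ((:# 1 :- :# 2 :* n) :* (:# 1 :- :# 2 :* n)) :+
              :# 2 :* ((s :- n) :* (s :- n)) :* (:# 1 :+ n)) refl n σ))
    by-cases (inj₂ σ-n≤1) (inj₁ 0≤σ-n) (inj₁ 1≤σ+n) =
      at (potential-mid 0≤σ-n σ-n≤1) (potential-≥1 1≤σ+n)
        (2*≤ (+-nonneg (*-nonneg (square-nonneg (σ - n))
                         (+-nonneg (≤⇒0≤- σ-n≤1) (fromℕ-nonneg 6)))
                       (*-nonneg (≤⇒0≤- 1≤σ+n)
                         (+-nonneg (fromℕ-nonneg 2) (square-nonneg (# 2 - (σ - n))))))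
          (solve 2 (λ n s →
              :# 2 :* (:# 9 :* s) :-
              :# 2 :* ((:# 1 :+ n) :* ((s :- n) :* (:# 4 :- (s :- n)) :+ :# 3)) :=
              (s :- n) :* (s :- n) :* (:# 1 :- (s :- n) :+ :# 6) :+
              (s :+ n :- :# 1) :* (:# 2 :+ (:# 2 :- (s :- n)) :* (:# 2 :- (s :- n)))) refl n σ))
    -- Here the left side is 4 σ (1 + n) (2 - n). The product (1 + n) (2 - n) peaks at n = 1/2 with
    -- value 9/4, which is the source of the constant 9.
    by-cases (inj₂ _) (inj₂ σ-n≤0) (inj₂ σ+n≤1) =
      at (potential-neg-mid (≤⇒0≤neg σ-n≤0) -[σ-n]≤1) (potential-mid 0≤σ+n σ+n≤1)
        (≤-from-diff (*-nonneg 0≤σ (square-nonneg (1# - # 2 * n)))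
          (solve 2 (λ n s →
              :# 9 :* s :-
              (:# 1 :+ n) :* ((s :- n) :* (:# 4 :+ (s :- n)) :+ (s :+ n) :* (:# 4 :- (s :+ n))) :=
              s :* ((:# 1 :- :# 2 :* n) :* (:# 1 :- :# 2 :* n))) refl n σ))
    by-cases (inj₂ _) (inj₂ σ-n≤0) (inj₁ 1≤σ+n) =
      at (potential-neg-mid (≤⇒0≤neg σ-n≤0) -[σ-n]≤1) (potential-≥1 1≤σ+n)
        (2*≤ (+-nonneg (*-nonneg (≤⇒0≤- -[σ-n]≤1) (square-nonneg (σ - n)))
               (*-nonneg (≤⇒0≤- 1≤σ+n)
                 (+-nonneg (fromℕ-nonneg 6)
                   (*-nonneg (≤⇒0≤neg σ-n≤0) (+-nonneg (fromℕ-nonneg 3) (≤⇒0≤- -[σ-n]≤1))))))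
          (solve 2 (λ n s →
              :# 2 :* (:# 9 :* s) :-
              :# 2 :* ((:# 1 :+ n) :* ((s :- n) :* (:# 4 :+ (s :- n)) :+ :# 3)) :=
              (:# 1 :- :- (s :- n)) :* ((s :- n) :* (s :- n)) :+
              (s :+ n :- :# 1) :* (:# 6 :+ :- (s :- n) :* (:# 3 :+ (:# 1 :- :- (s :- n))))) refl n σ))

  -- The potential on the unit strip

  Φ : Carrier → Carrier
  Φ u = potential (# 2 * u - 1#)

  Φ-mono : Monotone Φ
  Φ-mono u≤v = potential-mono
    (+-mono-≤ (*-monoʳ-≤ (fromℕ-nonneg 2) u≤v) ≤-refl)

  Φ-total : Φ 1# - Φ 0# ≈ # 6
  Φ-total = begin
    Φ 1# - Φ 0#
      ≈⟨ +-cong (potential-cong (solve 0 (:# 2 :* :# 1 :- :# 1 := :# 1) refl))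
                (-‿cong (potential-cong (solve 0 (:# 2 :* :# 0 :- :# 1 := :- :# 1) refl))) ⟩
    potential 1# - potential (- 1#)
      ≈⟨ +-congˡ (-‿cong (potential-odd 1#)) ⟩
    potential 1# - - potential 1#
      ≈⟨ +-cong (potential-≥1 ≤-refl) (-‿cong (-‿cong (potential-≥1 ≤-refl))) ⟩
    # 3 - - # 3
      ≈⟨ solve 0 (:# 3 :- :- :# 3 := :# 6) refl ⟩
    # 6 ∎

  -- In the coordinate v = 2u - 1 the sensor lies at distance n = |2x - 1| from the centre and has
  -- reach σ = 2ρ, while 2r = 1 + n. By oddness its two ends contribute `potential (σ - n)` and
  -- `potential (σ + n)`, so `spread-bound` applies. The two halves of the strip differ only in
  -- which end contributes which.
  Φ-bound : ∀ {x ρ} → x ∈[ 0# , 1# ] → 0# ≤ ρ →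
    max x (1# - x) * (Φ (x + ρ) - Φ (x - ρ)) ≤ # 9 * ρ
  Φ-bound {x} {ρ} (0≤x , x≤1) 0≤ρ = [ left , right ]′ (≤-total x (1# - x))
    where
    from-spread : ∀ {n r p q} → 0# ≤ n → n ≤ 1# → max x (1# - x) ≈ r → # 2 * r ≈ 1# + n →
      Φ (x + ρ) ≈ p → Φ (x - ρ) ≈ - q →
      p + q ≈ potential (# 2 * ρ - n) + potential (# 2 * ρ + n) →
      max x (1# - x) * (Φ (x + ρ) - Φ (x - ρ)) ≤ # 9 * ρ
    from-spread {n} {r} {p} {q} 0≤n n≤1 max≈r 2r≈1+n ≈p ≈q sum≈ =
      *-cancelˡ-≤ (0<fromℕ-suc 1) (≤-respˡ (sym lhs) (≤-respʳ
        (solve 1 (λ p → :# 9 :* (:# 2 :* p) := :# 2 :* (:# 9 :* p)) refl ρ)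
        (spread-bound 0≤n n≤1 (*-nonneg (fromℕ-nonneg 2) 0≤ρ))))
      where
      lhs : # 2 * (max x (1# - x) * (Φ (x + ρ) - Φ (x - ρ))) ≈
            (1# + n) * (potential (# 2 * ρ - n) + potential (# 2 * ρ + n))
      lhs = begin
        # 2 * (max x (1# - x) * (Φ (x + ρ) - Φ (x - ρ)))
          ≈⟨ *-congˡ (*-cong max≈r (+-cong ≈p (-‿cong ≈q))) ⟩
        # 2 * (r * (p - - q))
          ≈⟨ solve 3 (λ r p q → :# 2 :* (r :* (p :- :- q)) := :# 2 :* r :* (p :+ q)) refl r p q ⟩
        # 2 * r * (p + q)
          ≈⟨ *-cong 2r≈1+n sum≈ ⟩
        (1# + n) * (potential (# 2 * ρ - n) + potential (# 2 * ρ + n)) ∎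

    left : x ≤ 1# - x → max x (1# - x) * (Φ (x + ρ) - Φ (x - ρ)) ≤ # 9 * ρ
    left x≤1-x = from-spread {1# - # 2 * x}
      (≤-respʳ (solve 1 (λ x → :# 1 :- x :- x := :# 1 :- :# 2 :* x) refl x) (≤⇒0≤- x≤1-x))
      (≤-from-diff (*-nonneg (fromℕ-nonneg 2) 0≤x)
        (solve 1 (λ x → :# 1 :- (:# 1 :- :# 2 :* x) := :# 2 :* x) refl x))
      (x≤y⇒x⊔y≈y x≤1-x)
      (solve 1 (λ x → :# 2 :* (:# 1 :- x) := :# 1 :+ (:# 1 :- :# 2 :* x)) refl x)
      (potential-cong (solve 2 (λ x p → :# 2 :* (x :+ p) :- :# 1 :=
                         :# 2 :* p :- (:# 1 :- :# 2 :* x)) refl x ρ))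
      (trans (potential-cong (solve 2 (λ x p → :# 2 :* (x :- p) :- :# 1 :=
                                :- (:# 2 :* p :+ (:# 1 :- :# 2 :* x))) refl x ρ))
             (potential-odd _))
      refl

    right : 1# - x ≤ x → max x (1# - x) * (Φ (x + ρ) - Φ (x - ρ)) ≤ # 9 * ρ
    right 1-x≤x = from-spread {# 2 * x - 1#}
      (≤-respʳ (solve 1 (λ x → x :- (:# 1 :- x) := :# 2 :* x :- :# 1) refl x) (≤⇒0≤- 1-x≤x))
      (≤-from-diff (*-nonneg (fromℕ-nonneg 2) (≤⇒0≤- x≤1))
        (solve 1 (λ x → :# 1 :- (:# 2 :* x :- :# 1) := :# 2 :* (:# 1 :- x)) refl x))
      (x≤y⇒y⊔x≈y 1-x≤x)
      (solve 1 (λ x → :# 2 :* x := :# 1 :+ (:# 2 :* x :- :# 1)) refl x)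
      (potential-cong (solve 2 (λ x p → :# 2 :* (x :+ p) :- :# 1 :=
                         :# 2 :* p :+ (:# 2 :* x :- :# 1)) refl x ρ))
      (trans (potential-cong (solve 2 (λ x p → :# 2 :* (x :- p) :- :# 1 :=
                                :- (:# 2 :* p :- (:# 2 :* x :- :# 1))) refl x ρ))
             (potential-odd _))
      (+-comm _ _)

  -- Indicators and consecutive time slots

  indicator : ∀ {p} {P : Set p} → Dec P → Carrier
  indicator (yes _) = 1#
  indicator (no _)  = 0#

  indicator-nonneg : ∀ {p} {P : Set p} (P? : Dec P) → 0# ≤ indicator P?
  indicator-nonneg (yes _) = 0≤1
  indicator-nonneg (no _)  = ≤-refl

  indicator≤1 : ∀ {p} {P : Set p} (P? : Dec P) → indicator P? ≤ 1#
  indicator≤1 (yes _) = ≤-refl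
  indicator≤1 (no _)  = 0≤1

  indicator-true : ∀ {p} {P : Set p} (P? : Dec P) → P → indicator P? ≈ 1#
  indicator-true (yes _) _  = refl
  indicator-true (no ¬p) p = ⊥-elim (¬p p)

  indicator-false : ∀ {p} {P : Set p} (P? : Dec P) → ¬ P → indicator P? ≈ 0#
  indicator-false (yes p) ¬p = ⊥-elim (¬p p)
  indicator-false (no _)  _  = refl

  indicator-mono : ∀ {p q} {P : Set p} {Q : Set q} (P? : Dec P) (Q? : Dec Q) →
    (P → Q) → indicator P? ≤ indicator Q?
  indicator-mono (yes p) Q? P⇒Q = ≤-reflexive (sym (indicator-true Q? (P⇒Q p)))
  indicator-mono (no _)  Q? _   = indicator-nonneg Q?

  prefix-sum : ∀ {n} → Vector Carrier n → Fin n → Carrier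
  prefix-sum f i = sum λ (j : Fin′ i) → f (inject j)

  -- Walk along the slots, subtracting the length of each slot passed. Nonemptiness provides a slot
  -- even at time 0.
  prefix-sum-covers : ∀ {n} .{{_ : NonZero n}} {f : Vector Carrier n} {t} → 0# ≤ t → t ≤ sum f →
    ∃ λ i → t ∈[ prefix-sum f i , prefix-sum f i + f i ]
  prefix-sum-covers {suc n} {f} {t} 0≤t t≤sum with t ≤? f zero
  ... | yes t≤f₀ = zero , 0≤t , ≤-respʳ (sym (+-identityˡ _)) t≤f₀
  -- The last slot is treated separately, so that the recursive call always has a slot left.
  prefix-sum-covers {suc zero} {f} {t} 0≤t t≤sum | no t≰f₀ =
    ⊥-elim (t≰f₀ (≤-respʳ (+-identityʳ _) t≤sum))
  prefix-sum-covers {suc (suc n)} {f} {t} 0≤t t≤sum | no t≰f₀ =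
    let i , lower , upper = prefix-sum-covers {suc n} {f ∘ suc} {t - f zero}
          (≤⇒0≤- (≰⇒≥ t≰f₀))
          (≤-from-diff (≤⇒0≤- t≤sum)
            (solve 3 (λ t a s → s :- (t :- a) := a :+ s :- t) refl t (f zero) (sum (f ∘ suc))))
    in suc i ,
       ≤-from-diff (≤⇒0≤- lower)
         (solve 3 (λ t a p → t :- (a :+ p) := t :- a :- p) refl t (f zero) (prefix-sum (f ∘ suc) i)) ,
       ≤-from-diff (≤⇒0≤- upper)
         (solve 4 (λ t a p b → a :+ p :+ b :- t := p :+ b :- (t :- a)) refl
           t (f zero) (prefix-sum (f ∘ suc) i) (f (suc i)))

  prefix-sum+≤sum : ∀ {n} {f : Vector Carrier n} → (∀ i → 0# ≤ f i) →
    ∀ i → prefix-sum f i + f i ≤ sum f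
  prefix-sum+≤sum {suc n} {f} 0≤f zero =
    ≤-respˡ (+-comm _ _) (+-mono-≤ ≤-refl (sum-nonneg (0≤f ∘ suc)))
  prefix-sum+≤sum {suc n} {f} 0≤f (suc i) = ≤-respˡ (sym (+-assoc _ _ _))
    (+-mono-≤ ≤-refl (prefix-sum+≤sum (0≤f ∘ suc) i))

  -- Validity and lifetime of RoundRobin

  open SetOnceStripCover R

  module _ {n} (I : Instance n) where

    open Instance I

    share : Vector Carrier n
    share i = battery i / r I i

    r-bounds : ∀ i → r I i ∈[ 0# , 1# ]
    r-bounds i = ≤-trans 0≤x (x≤x⊔y _ _) , ⊔-lub x≤1
      (≤-from-diff 0≤x (solve 1 (λ x → :# 1 :- (:# 1 :- x) := x) refl (location i)))
      where
      0≤x = proj₁ (location∈[0,1] i)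
      x≤1 = proj₂ (location∈[0,1] i)

    -- `location i` and its complement add up to 1, so they cannot both be at most 0.
    0<r : ∀ i → 0# < r I i
    0<r i = proj₁ (r-bounds i) , λ 0≈r → 0≉1 (≤-antisym 0≤1
      (≤-respˡ (solve 1 (λ x → x :+ (:# 1 :- x) := :# 1) refl (location i))
        (≤-respʳ (+-identityʳ 0#) (+-mono-≤
          (≤-respʳ (sym 0≈r) (x≤x⊔y (location i) (1# - location i)))
          (≤-respʳ (sym 0≈r) (x≤y⊔x (location i) (1# - location i)))))))

    battery-nonneg : ∀ i → 0# ≤ battery i
    battery-nonneg i = fromℚ-nonneg (charge-nonneg i)

    share-nonneg : ∀ i → 0# ≤ share i
    share-nonneg i = *-nonneg (battery-nonneg i) (⁻¹-nonneg (0<r i))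

    roundRobin-valid : IsValid (roundRobin I)
    roundRobin-valid = r-bounds ,
      λ i → sum-nonneg {f = λ (j : Fin′ i) → share (inject j)} (share-nonneg ∘ inject)

    r-reach : ∀ i {u} → u ∈[ 0# , 1# ] → u ∈[ location i - r I i , location i + r I i ]
    r-reach i (0≤u , u≤1) =
      ≤-trans (≤-from-diff (≤⇒0≤- (x≤x⊔y (location i) (1# - location i)))
        (solve 2 (λ x r → :# 0 :- (x :- r) := r :- x) refl (location i) (r I i))) 0≤u ,
      ≤-trans u≤1 (≤-from-diff (≤⇒0≤- (x≤y⊔x (location i) (1# - location i)))
        (solve 2 (λ x r → x :+ r :- :# 1 := r :- (:# 1 :- x)) refl (location i) (r I i)))

    roundRobin-lifetime : .{{_ : NonZero n}} → HasLifetime I (roundRobin I) (RR I)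
    roundRobin-lifetime = (sum-nonneg share-nonneg , covers) , maximal
      where
      covers : ∀ u t → u ∈[ 0# , 1# ] → t ∈[ 0# , RR I ] → Covered I (roundRobin I) u t
      covers u t u∈ (0≤t , t≤RR) =
        let i , t∈ = prefix-sum-covers {f = share} 0≤t t≤RR in i , 0<r i , r-reach i u∈ , t∈

      maximal : ∀ T → CoversUntil I (roundRobin I) T → T ≤ RR I
      maximal T (0≤T , cover) =
        -- One point of the strip suffices: whichever sensor covers it at time `T`, its slot ends no
        -- later than the last one.
        let i , _ , _ , _ , T≤end = cover 0# T (≤-refl , 0≤1) (0≤T , ≤-refl)
        in ≤-trans T≤end (prefix-sum+≤sum share-nonneg i)

    -- Comparison with an arbitrary schedule

    module _ (S : Schedule n) (valid : IsValid S) where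

      open Schedule S

      private
        x = location
        ρ = radius
        τ = activation

      0≤ρ : ∀ i → 0# ≤ ρ i
      0≤ρ i = proj₁ (proj₁ valid i)

      _∈?[_,_] : ∀ t a b → Dec (t ∈[ a , b ])
      t ∈?[ a , b ] = (a ≤? t) ×-dec (t ≤? b)

      Active : Fin n → Carrier → Set _
      Active i t = 0# < ρ i × t ∈[ τ i , τ i + battery i / ρ i ]

      active? : ∀ i t → Dec (Active i t)
      active? i t = (0# <? ρ i) ×-dec (t ∈?[ τ i , τ i + battery i / ρ i ])

      covers? : ∀ i u t → Dec (SensorCovers I S i u t)
      covers? i u t = (0# <? ρ i) ×-dec ((u ∈?[ x i - ρ i , x i + ρ i ]) ×-dec
                        (t ∈?[ τ i , τ i + battery i / ρ i ]))

      -- Enters twice: as the increment of `Φ` when covering space, and as the weight of a sensor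
      -- when covering time.
      gain : Vector Carrier n
      gain i = Φ (x i + ρ i) - Φ (x i - ρ i)

      x-ρ≤x+ρ : ∀ i → x i - ρ i ≤ x i + ρ i
      x-ρ≤x+ρ i = ≤-from-diff (+-nonneg (0≤ρ i) (0≤ρ i))
        (solve 2 (λ x p → x :+ p :- (x :- p) := p :+ p) refl (x i) (ρ i))

      gain-nonneg : ∀ i → 0# ≤ gain i
      gain-nonneg i = ≤⇒0≤- (Φ-mono (x-ρ≤x+ρ i))

      -- Zero when ρ i is, as then b / ρ is a junk value.
      duration : Vector Carrier n
      duration i = indicator (0# <? ρ i) * (battery i / ρ i)

      duration≈ : ∀ i → 0# < ρ i → duration i ≈ battery i / ρ i
      duration≈ i 0<ρ = trans (*-congʳ (indicator-true (0# <? ρ i) 0<ρ)) (*-identityˡ _)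

      duration-nonneg : ∀ i → 0# ≤ duration i
      duration-nonneg i with 0# <? ρ i
      ... | yes 0<ρ = *-nonneg 0≤1 (*-nonneg (battery-nonneg i) (⁻¹-nonneg 0<ρ))
      ... | no _    = ≤-reflexive (sym (zeroˡ _))

      -- Multiplying `Φ-bound` by b / (r ρ) cancels `r` on the left and ρ on the right. The radius
      -- chosen by the schedule thus disappears, leaving the RoundRobin share of the sensor.
      gain*duration≤ : ∀ i → gain i * duration i ≤ # 9 * share i
      gain*duration≤ i = [ active , inactive ]′ (toSum (0# <? ρ i))
        where
        inactive : ¬ 0# < ρ i → gain i * duration i ≤ # 9 * share i
        inactive ¬0<ρ = ≤-respˡ
          (sym (trans (*-congˡ (trans (*-congʳ (indicator-false (0# <? ρ i) ¬0<ρ)) (zeroˡ _)))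
                      (zeroʳ _)))
          (*-nonneg (fromℕ-nonneg 9) (share-nonneg i))

        active : 0# < ρ i → gain i * duration i ≤ # 9 * share i
        active 0<ρ = ≤-respˡ lhs (≤-respʳ rhs
          (*-monoʳ-≤ (*-nonneg (share-nonneg i) (⁻¹-nonneg 0<ρ))
                     (Φ-bound (location∈[0,1] i) (0≤ρ i))))
          where
          b = battery i
          r⁻¹ = r I i ⁻¹
          ρ⁻¹ = ρ i ⁻¹
          lhs : share i * ρ⁻¹ * (r I i * gain i) ≈ gain i * duration i
          lhs = begin
            b * r⁻¹ * ρ⁻¹ * (r I i * gain i)
              ≈⟨ solve 5 (λ b r r' p' g → b :* r' :* p' :* (r :* g) := r :* r' :* (g :* (b :* p')))
                   refl b (r I i) r⁻¹ ρ⁻¹ (gain i) ⟩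
            r I i * r⁻¹ * (gain i * (b * ρ⁻¹))  ≈⟨ *-congʳ (*-⁻¹ (0<r i)) ⟩
            1# * (gain i * (b * ρ⁻¹))           ≈⟨ *-identityˡ _ ⟩
            gain i * (b * ρ⁻¹)                  ≈⟨ *-congˡ (duration≈ i 0<ρ) ⟨
            gain i * duration i                 ∎
          rhs : share i * ρ⁻¹ * (# 9 * ρ i) ≈ # 9 * share i
          rhs = begin
            share i * ρ⁻¹ * (# 9 * ρ i)
              ≈⟨ solve 3 (λ s p p' → s :* p' :* (:# 9 :* p) := (p :* p') :* (:# 9 :* s)) refl
                   (share i) (ρ i) ρ⁻¹ ⟩
            ρ i * ρ⁻¹ * (# 9 * share i)         ≈⟨ *-congʳ (*-⁻¹ 0<ρ) ⟩
            1# * (# 9 * share i)                ≈⟨ *-identityˡ _ ⟩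
            # 9 * share i                       ∎

      module _ {T} (cover : CoversUntil I S T) where

        -- The step in space, at a frozen time `t`: active sensors have weight 1 and the others 0,
        -- the cover has level 1 on (0 , 1), and `Φ` rises by 6 there.
        active-gain : ∀ t → t ∈[ 0# , T ] → # 6 ≤ sum λ i → indicator (active? i t) * gain i
        active-gain t t∈ = ≤-respˡ (trans (*-identityˡ _) Φ-total)
          (interval-cover {φ = λ i u → indicator (covers? i u t)}
            x-ρ≤x+ρ
            (λ i → indicator-nonneg (active? i t))
            (λ i u → indicator-mono (covers? i u t) (active? i t) (λ (0<ρ , _ , t∈) → 0<ρ , t∈))
            (λ i u u∉ → ≤-reflexive (indicator-false (covers? i u t) (λ (_ , u∈ , _) → u∉ u∈)))
            0≤1
            (λ u 0<u u<1 →
              let i , covered = proj₂ cover u t (<⇒≤ 0<u , <⇒≤ u<1) t∈ in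
              ≤-respˡ (indicator-true (covers? i u t) covered)
                (term≤sum {f = λ i → indicator (covers? i u t)}
                  (λ i → indicator-nonneg (covers? i u t)) i))
            {Φ} Φ-mono)

        -- The step in time: `active-gain` supplies the level 6 on (0 , T), the weights are the
        -- gains, and `G = id` turns the increments into durations.
        6T≤9RR : # 6 * T ≤ # 9 * RR I
        6T≤9RR = ≤-respˡ (*-congˡ (solve 1 (λ t → t :- :# 0 := t) refl T))
          (≤-trans
            (interval-cover {l = τ} {h = λ i → τ i + duration i} {w = gain}
              {φ = λ i t → indicator (active? i t) * gain i}
              (λ i → ≤-respˡ (+-identityʳ _) (+-monoʳ-≤ (τ i) (duration-nonneg i)))
              gain-nonneg
              (λ i t → ≤-respˡ (*-comm _ _) (≤-respʳ (*-identityʳ _)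
                (*-monoʳ-≤ (gain-nonneg i) (indicator≤1 (active? i t)))))
              (λ i t t∉ → ≤-reflexive (trans (*-congʳ (indicator-false (active? i t)
                (λ (0<ρ , τ≤t , t≤end) →
                  t∉ (τ≤t , ≤-respʳ (+-congˡ (sym (duration≈ i 0<ρ))) t≤end)))) (zeroˡ _)))
              (proj₁ cover)
              (λ t 0<t t<T → active-gain t (<⇒≤ 0<t , <⇒≤ t<T))
              {id} id)
            (≤-respʳ (sym (*-distribˡ-sum (# 9) share))
              (sum-mono-≤ (λ i → ≤-respˡ
                (*-congˡ (solve 2 (λ t d → d := t :+ d :- t) refl (τ i) (duration i)))
                (gain*duration≤ i)))))

        approximation : fromℚ (+ 2 ℚ./ 3) * T ≤ RR I
        -- `fromℚ (+ 2 ℚ./ 3)` evaluates to `# 2 * # 3 ⁻¹`, and nine times it is 6.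
        approximation = *-cancelˡ-≤ (0<fromℕ-suc 8) (≤-respˡ (begin
          # 6 * T                          ≈⟨ *-identityˡ _ ⟨
          1# * (# 6 * T)                   ≈⟨ *-congʳ (*-⁻¹ (0<fromℕ-suc 2)) ⟨
          # 3 * # 3 ⁻¹ * (# 6 * T)         ≈⟨ solve 2 (λ w t → :# 3 :* w :* (:# 6 :* t) := :# 9 :* (:# 2 :* w :* t))
                                                refl (# 3 ⁻¹) T ⟩
          # 9 * (# 2 * # 3 ⁻¹ * T)         ∎) 6T≤9RR)

theorem2 : ∀ {c ℓ₁ ℓ₂} (R : RealNumbers c ℓ₁ ℓ₂) →
    let open RealNumbers R
        open SetOnceStripCover R in
    ∀ (n : ℕ) .{{_ : NonZero n}} (I : Instance n) →
      IsValid (roundRobin I) ×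
      HasLifetime I (roundRobin I) (RR I) ×
      (∀ opt → IsOpt I opt → fromℚ (+ 2 ℚ./ 3) * opt ≤ RR I) ×
      (∀ S T → IsValid S → HasLifetime I S T → fromℚ (+ 2 ℚ./ 3) * T ≤ RR I)
theorem2 R n I =
  roundRobin-valid I ,
  roundRobin-lifetime I ,
  -- The optimum is attained, so the bound is applied to a schedule attaining it.
  (λ opt ((S , valid , covers , _) , _) → approximation I S valid covers) ,
  (λ S T valid (covers , _) → approximation I S valid covers)
  where open RoundRobin R using (roundRobin-valid; roundRobin-lifetime; approximation)
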